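{- For every connected graph $G$ and every positive integer $q$, \[\mathcal{B}_q(G) = \max\left\{\chi(G),\ \left\lceil \frac{\chi(G)}{2}\right\rceil + q\right\}.\]
   Context: All graphs are simple. A proper $k$-coloring of a graph $G$ is a function $c: V(G)\to\{1,\ldots,k\}$ such that $c(u)\neq c(v)$ for every $uv\in E(G)$ (not all colors need be used), and $\chi(G)$ is the smallest positive integer $k$ for which $G$ has a proper $k$-coloring. Given a spanning subgraph $H$ of $G$ and positive integers $k$ and $q$, a $q$-backbone $k$-coloring of $(G,H)$ is a proper $k$-coloring $c$ of $G$ such that $|c(u)-c(v)|\ge q$ for every $uv\in E(H)$. The $q$-backbone chromatic number $BBC_q(G,H)$ is the smallest integer $k$ for which $(G,H)$ admits a $q$-backbone $k$-coloring. For a connected graph $G$ and a positive integer $q$, $\mathcal{B}_q(G) = \min\{BBC_q(G,T) : T \text{ is a spanning tree of } G\}$.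
   Formalization: The graph is required to have at least two vertices, because for the one-vertex graph the left side is 1 while the formula gives 1+q; graphs are finite with decidable adjacency. -}

module Defs where

open import Data.Fin.Base
  using (Fin; zero; suc; toℕ; fromℕ; inject₁; combine; finToFun; funToFin)
open import Data.Fin.Properties
  using (any?; all?; _≟_; toℕ-injective; toℕ-inject₁; inject₁-injective;
         toℕ-combine; combine-injectiveˡ; finToFun-funToFin)
open import Data.Nat.Base
  using (ℕ; suc; _*_; _≤_; _<_; s≤s; z≤n; ∣_-_∣; >-nonZero)
open import Data.Nat.Properties
  using (_<?_; _≤?_; ≮⇒≥; anyUpTo?; n≢0⇒n>0; n≤1+n; m≤m*n; +-identityʳ;
         *-distribˡ-∣-∣; ∣m-n∣≡0⇒m≡n; module ≤-Reasoning)
open import Data.Nat.Induction using (<-rec)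
open import Data.Product.Base using (∃; ∃-syntax; _×_; _,_; proj₁; proj₂)
open import Function.Definitions using (Injective)
open import Level using (0ℓ)
open import Relation.Binary.Construct.Closure.ReflexiveTransitive using (Star)
open import Relation.Binary.Core using (Rel)
open import Relation.Binary.Definitions using (Decidable; Symmetric)
open import Relation.Binary.PropositionalEquality.Core
  using (_≡_; _≢_; refl; sym; trans; cong₂; subst)
open import Relation.Nullary.Decidable using (Dec; yes; no; map′; ¬?; _×-dec_; _→-dec_)
open import Relation.Nullary.Negation using (¬_)
import Relation.Unary as U

IsMinimum : ∀ {ℓ} → (ℕ → Set ℓ) → ℕ → Set ℓ
IsMinimum P k = P k × (∀ j → P j → k ≤ j)

record Graph (n : ℕ) : Set₁ where
  field
    _~_      : Rel (Fin n) 0ℓ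
    _~?_     : Decidable _~_
    ~-sym    : Symmetric _~_
    ~-irrefl : ∀ {v} → ¬ (v ~ v)

private
  variable
    n : ℕ

Connected : Graph n → Set
Connected G = ∀ u v → Star (Graph._~_ G) u v

-- A cycle of length m + 3, given by its vertices in cyclic order.
record Cycle (G : Graph n) : Set where
  open Graph G
  field
    {m}       : ℕ
    vertex    : Fin (suc (suc (suc m))) → Fin n
    injective : Injective _≡_ _≡_ vertex
    step      : ∀ i → vertex (inject₁ i) ~ vertex (suc i)
    close     : vertex (fromℕ (suc (suc m))) ~ vertex zero

IsTree : Graph n → Set
IsTree G = Connected G × ¬ Cycle G

-- Both graphs have vertex set Fin n, so every such subgraph is spanning.
_⊆_ : Graph n → Graph n → Set
H ⊆ G = ∀ {u v} → Graph._~_ H u v → Graph._~_ G u v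

IsSpanningTree : Graph n → Graph n → Set
IsSpanningTree G T = T ⊆ G × IsTree T

-- Colours are Fin k, i.e. {0, …, k - 1} instead of {1, …, k}; only equality
-- and differences of colours are ever used.
Proper : Graph n → (k : ℕ) → (Fin n → Fin k) → Set
Proper G k c = ∀ u v → Graph._~_ G u v → c u ≢ c v

Backbone : Graph n → Graph n → ℕ → (k : ℕ) → (Fin n → Fin k) → Set
Backbone G H q k c =
  Proper G k c × (∀ u v → Graph._~_ H u v → q ≤ ∣ toℕ (c u) - toℕ (c v) ∣)

Colorable : Graph n → ℕ → Set
Colorable G k = 0 < k × ∃[ c ] Proper G k c

BackboneColorable : Graph n → Graph n → ℕ → ℕ → Set
BackboneColorable G H q k = 0 < k × ∃[ c ] Backbone G H q k c

proper? : (G : Graph n) → ∀ k → U.Decidable (Proper G k)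
proper? G k c = all? λ u → all? λ v → (u ~? v) →-dec ¬? (c u ≟ c v)
  where open Graph G

backbone? : (G H : Graph n) → ∀ q k → U.Decidable (Backbone G H q k)
backbone? G H q k c = proper? G k c ×-dec
  (all? λ u → all? λ v → (u ~? v) →-dec (q ≤? ∣ toℕ (c u) - toℕ (c v) ∣))
  where open Graph H

proper-resp : (G : Graph n) → ∀ {k c d} → (∀ v → c v ≡ d v) →
              Proper G k c → Proper G k d
proper-resp G c≗d p u v e eq = p u v e (trans (c≗d u) (trans eq (sym (c≗d v))))

backbone-resp : (G H : Graph n) → ∀ {q k c d} → (∀ v → c v ≡ d v) →
                Backbone G H q k c → Backbone G H q k d
backbone-resp G H {q} c≗d (p , b) = proper-resp G c≗d p , λ u v e →
  subst (q ≤_) (cong₂ (λ i j → ∣ toℕ i - toℕ j ∣) (c≗d u) (c≗d v)) (b u v e)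

anyColoring? : ∀ {k} {P : (Fin n → Fin k) → Set} → U.Decidable P →
               (∀ {c d} → (∀ v → c v ≡ d v) → P c → P d) → Dec (∃ P)
anyColoring? P? resp = map′
  (λ (i , p) → finToFun i , p)
  (λ (c , p) → funToFin c , resp (λ v → sym (finToFun-funToFin c v)) p)
  (any? λ i → P? (finToFun i))

colorable? : (G : Graph n) → U.Decidable (Colorable G)
colorable? G k = (0 <? k) ×-dec anyColoring? (proper? G k) (proper-resp G)

backboneColorable? : (G H : Graph n) → ∀ q → U.Decidable (BackboneColorable G H q)
backboneColorable? G H q k =
  (0 <? k) ×-dec anyColoring? (backbone? G H q k) (backbone-resp G H)

injective⇒proper : (G : Graph n) → ∀ {k c} → Injective _≡_ _≡_ c → Proper G k c
injective⇒proper G inj u v e eq with refl ← inj eq = Graph.~-irrefl G e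

colorable-suc : (G : Graph n) → Colorable G (suc n)
colorable-suc G = s≤s z≤n , inject₁ , injective⇒proper G inject₁-injective

-- Vertex v receives colour (q + 1) v.
backboneColorable-suc : (G H : Graph n) → ∀ q →
                        BackboneColorable G H q (suc (n * suc q))
backboneColorable-suc {n} G H q =
  s≤s z≤n , c , injective⇒proper G c-injective , far
  where
  c : Fin n → Fin (suc (n * suc q))
  c v = inject₁ (combine v (zero {q}))

  c-injective : Injective _≡_ _≡_ c
  c-injective {u} {v} eq = combine-injectiveˡ u zero v zero (inject₁-injective eq)

  toℕ-c : ∀ v → toℕ (c v) ≡ suc q * toℕ v
  toℕ-c v = trans (toℕ-inject₁ _)
    (trans (toℕ-combine v (zero {q})) (+-identityʳ _))

  far : ∀ u v → Graph._~_ H u v → q ≤ ∣ toℕ (c u) - toℕ (c v) ∣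
  far u v e = begin
    q                                      ≤⟨ n≤1+n q ⟩
    suc q                                  ≤⟨ m≤m*n (suc q) _ ⦃ >-nonZero (n≢0⇒n>0 u≉v) ⦄ ⟩
    suc q * ∣ toℕ u - toℕ v ∣               ≡⟨ *-distribˡ-∣-∣ (suc q) (toℕ u) (toℕ v) ⟩
    ∣ suc q * toℕ u - suc q * toℕ v ∣       ≡⟨ cong₂ ∣_-_∣ (toℕ-c u) (toℕ-c v) ⟨
    ∣ toℕ (c u) - toℕ (c v) ∣               ∎
    where
    open ≤-Reasoning
    u≉v : ∣ toℕ u - toℕ v ∣ ≢ 0
    u≉v eq with refl ← toℕ-injective {i = u} {v} (∣m-n∣≡0⇒m≡n eq) = Graph.~-irrefl H e

minimum : {P : ℕ → Set} → U.Decidable P → ∀ k → P k → ∃ (IsMinimum P)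
minimum {P} P? = <-rec (λ k → P k → ∃ (IsMinimum P)) search
  where
  search : ∀ k → (∀ {j} → j < k → P j → ∃ (IsMinimum P)) → P k → ∃ (IsMinimum P)
  search k rec pk with anyUpTo? P? k
  ... | yes (j , j<k , pj) = rec j<k pj
  ... | no none = k , pk , λ j pj → ≮⇒≥ λ j<k → none (j , j<k , pj)

chromaticNumber : (G : Graph n) → ∃ (IsMinimum (Colorable G))
chromaticNumber {n} G = minimum (colorable? G) (suc n) (colorable-suc G)

χ : Graph n → ℕ
χ G = proj₁ (chromaticNumber G)

χ-isMinimum : (G : Graph n) → IsMinimum (Colorable G) (χ G)
χ-isMinimum G = proj₂ (chromaticNumber G)

backboneChromaticNumber : ∀ q (G H : Graph n) → ∃ (IsMinimum (BackboneColorable G H q))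
backboneChromaticNumber {n} q G H =
  minimum (backboneColorable? G H q) (suc (n * suc q)) (backboneColorable-suc G H q)

BBC : ℕ → Graph n → Graph n → ℕ
BBC q G H = proj₁ (backboneChromaticNumber q G H)

BBC-isMinimum : ∀ q (G H : Graph n) → IsMinimum (BackboneColorable G H q) (BBC q G H)
BBC-isMinimum q G H = proj₂ (backboneChromaticNumber q G H)

-- 𝓑_q(G) = b.
Is𝓑 : ℕ → Graph n → ℕ → Set₁
Is𝓑 q G = IsMinimum λ b → ∃[ T ] IsSpanningTree G T × BBC q G T ≡ b

-- Upper bound.  In any proper k-colouring of a connected graph the colours can be
-- changed so that the edges whose ends have consecutive colours contain a spanning
-- tree: grow a tree along such edges; if no edge leaving it is of this kind, take
-- an edge s ~ w leaving it and exchange, outside the tree only, the colour of w with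
-- the next colour in the direction of the colour of s.  The only edges that could
-- become monochromatic join consecutive colours across the boundary, and there are
-- none.  Take k = χ and put d = ⌊χ/2⌋ ⊔ q: the substitution 2i ↦ d + i, 2i + 1 ↦ i
-- pulls consecutive colours at least d apart and uses ⌈χ/2⌉ + d colours.
--
-- Lower bound.  Every vertex has a neighbour in the tree, so a q-backbone colouring
-- with q + e colours uses only the e lowest and the e highest colours.  Hence χ ≤ 2e.
module Submission where

open import Defs
open import Data.Empty using (⊥; ⊥-elim)
open import Data.Fin.Base
  using (Fin; zero; suc; toℕ; fromℕ; fromℕ<; inject₁; join; splitAt; punchIn)
open import Data.Fin.Permutation.Components using (transpose; transpose-inverse)
open import Data.Fin.Properties
  using (_≟_; all?; any?; toℕ<n; toℕ-injective; toℕ-fromℕ<; toℕ-inject₁;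
         fromℕ<-injective; splitAt-join; injective⇒≤; punchInᵢ≢i; ¬∀⟶∃¬)
open import Data.Fin.Relation.Unary.Top using (view; ‵fromℕ; ‵inject₁)
open import Data.List.Base using (List; _∷_; [_]; length; lookup)
import Data.List.Membership.DecPropositional as DecMembership
open import Data.List.Membership.Propositional using (_∈_; _∉_)
open import Data.List.Membership.Propositional.Properties using (∈-lookup)
open import Data.List.Relation.Unary.Any using (here; there)
open import Data.Nat.Base
  using (ℕ; zero; suc; _≤_; _<_; _+_; _∸_; _⊔_; ⌈_/2⌉; ⌊_/2⌋; ∣_-_∣; z≤n; s≤s)
open import Data.Nat.Induction using (<-wellFounded)
import Data.Nat.Properties as ℕ
open import Data.Product.Base using (∃; ∃-syntax; _×_; _,_; proj₁; proj₂)
open import Data.Sum.Base using (_⊎_; inj₁; inj₂)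
open import Data.Sum.Properties using (inj₁-injective; inj₂-injective)
open import Function.Base using (_∘_; id)
open import Function.Definitions using (Injective)
open import Induction.WellFounded using (Acc; acc)
open import Level using (0ℓ)
open import Relation.Binary.Construct.Closure.ReflexiveTransitive
  using (Star; ε; _◅_; _◅◅_; gmap; reverse)
open import Relation.Binary.Core using (Rel)
open import Relation.Binary.Definitions using (Symmetric)
open import Relation.Binary.PropositionalEquality
  using (_≡_; _≢_; refl; sym; trans; cong; cong₂; subst; subst₂)
open import Relation.Nullary.Decidable using (Dec; yes; no; ¬?; _×-dec_; _⊎-dec_)
open import Relation.Nullary.Negation using (¬_)
import Relation.Unary as U

private
  variable
    n k : ℕ

-- Walks, cycles and trees grown leaf by leaf.

_∈?_ : (v : Fin n) (vs : List (Fin n)) → Dec (v ∈ vs)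
_∈?_ = DecMembership._∈?_ _≟_

crossing : {A : Set} {R : Rel A 0ℓ} {P : A → Set} → U.Decidable P →
           ∀ {u v} → Star R u v → P u → ¬ P v →
           ∃[ s ] ∃[ w ] P s × ¬ P w × R s w
crossing P? ε pu ¬pv = ⊥-elim (¬pv pu)
crossing P? (_◅_ {j = w} e p) pu ¬pv with P? w
... | yes pw = crossing P? p pw ¬pv
... | no ¬pw = _ , w , pu , ¬pw , e

neighbour : (G : Graph n) → 2 ≤ n → Connected G → ∀ v → ∃[ w ] Graph._~_ G v w
-- `punchIn v zero` is some vertex other than `v`; a walk to it has a first edge.
neighbour {suc (suc _)} G (s≤s (s≤s _)) conn v with conn v (punchIn v zero) | punchInᵢ≢i v zero
... | p | v'≢v = first p (v'≢v ∘ sym)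
  where
  first : ∀ {u} → Star (Graph._~_ G) v u → v ≢ u → ∃[ w ] Graph._~_ G v w
  first ε v≢v = ⊥-elim (v≢v refl)
  first (e ◅ _) _ = _ , e

cycle-neighbours : (G : Graph n) (C : Cycle G) → let open Graph G; open Cycle C in
  ∀ i → ∃[ j ] ∃[ l ] j ≢ l × vertex i ~ vertex j × vertex i ~ vertex l
cycle-neighbours G C i with view i
... | ‵fromℕ = zero , inject₁ (fromℕ _) , (λ ()) , close , ~-sym (step (fromℕ _))
  where open Graph G; open Cycle C
... | ‵inject₁ zero = suc zero , fromℕ _ , (λ ()) , step zero , ~-sym close
  where open Graph G; open Cycle C
... | ‵inject₁ (suc j) =
  suc (suc j) , inject₁ (inject₁ j) , distinct , step (suc j) , ~-sym (step (inject₁ j))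
  where
  open Graph G; open Cycle C
  distinct : suc (suc j) ≢ inject₁ (inject₁ j)
  distinct eq = ℕ.<⇒≢ (ℕ.m≤n⇒m≤1+n ℕ.≤-refl)
    (sym (trans (cong toℕ eq) (trans (toℕ-inject₁ (inject₁ j)) (toℕ-inject₁ j))))

-- Trees on the listed vertices, with edges in R, built up by attaching leaves.
data Grown (R : Rel (Fin n) 0ℓ) : List (Fin n) → Set where
  root : ∀ r → Grown R [ r ]
  grow : ∀ {s w vs} → Grown R vs → s ∈ vs → w ∉ vs → R s w → Grown R (w ∷ vs)

module _ {R : Rel (Fin n) 0ℓ} where

  lookup-injective : ∀ {vs} → Grown R vs → Injective _≡_ _≡_ (lookup vs)
  lookup-injective (root r) {zero} {zero} eq = refl
  lookup-injective (grow t _ w∉vs _) {zero} {zero} eq = refl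
  lookup-injective (grow t _ w∉vs _) {zero} {suc j} refl = ⊥-elim (w∉vs (∈-lookup j))
  lookup-injective (grow t _ w∉vs _) {suc i} {zero} refl = ⊥-elim (w∉vs (∈-lookup i))
  lookup-injective (grow t _ w∉vs _) {suc i} {suc j} eq = cong suc (lookup-injective t eq)

  length≤ : ∀ {vs} → Grown R vs → length vs ≤ n
  length≤ t = injective⇒≤ (lookup-injective t)

  -- Each attached edge is stored in both orientations, so symmetry does not rest on `R`; only
  -- `edge⇒R` asks `R` to be symmetric.
  Edge : ∀ {vs} → Grown R vs → Rel (Fin n) 0ℓ
  Edge (root r) u v = ⊥
  Edge (grow {s} {w} t _ _ _) u v = (Edge t u v ⊎ (u ≡ s × v ≡ w)) ⊎ (u ≡ w × v ≡ s)

  edge? : ∀ {vs} (t : Grown R vs) u v → Dec (Edge t u v)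
  edge? (root r) u v = no λ ()
  edge? (grow {s} {w} t _ _ _) u v =
    (edge? t u v ⊎-dec ((u ≟ s) ×-dec (v ≟ w))) ⊎-dec ((u ≟ w) ×-dec (v ≟ s))

  edge-sym : ∀ {vs} (t : Grown R vs) → Symmetric (Edge t)
  edge-sym (grow t _ _ _) (inj₁ (inj₁ e)) = inj₁ (inj₁ (edge-sym t e))
  edge-sym (grow t _ _ _) (inj₁ (inj₂ (p , q))) = inj₂ (q , p)
  edge-sym (grow t _ _ _) (inj₂ (p , q)) = inj₁ (inj₂ (q , p))

  edge-∈ : ∀ {vs} (t : Grown R vs) {u v} → Edge t u v → u ∈ vs
  edge-∈ (grow t s∈vs _ _) (inj₁ (inj₁ e)) = there (edge-∈ t e)
  edge-∈ (grow t s∈vs _ _) (inj₁ (inj₂ (refl , _))) = there s∈vs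
  edge-∈ (grow t s∈vs _ _) (inj₂ (refl , _)) = here refl

  edge-irrefl : ∀ {vs} (t : Grown R vs) {v} → ¬ Edge t v v
  edge-irrefl (grow t _ _ _) (inj₁ (inj₁ e)) = edge-irrefl t e
  edge-irrefl (grow t s∈vs w∉vs _) (inj₁ (inj₂ (refl , refl))) = w∉vs s∈vs
  edge-irrefl (grow t s∈vs w∉vs _) (inj₂ (refl , refl)) = w∉vs s∈vs

  edge⇒R : Symmetric R → ∀ {vs} (t : Grown R vs) {u v} → Edge t u v → R u v
  edge⇒R R-sym (grow t _ _ _) (inj₁ (inj₁ e)) = edge⇒R R-sym t e
  edge⇒R R-sym (grow t _ _ r) (inj₁ (inj₂ (refl , refl))) = r
  edge⇒R R-sym (grow t _ _ r) (inj₂ (refl , refl)) = R-sym r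

  graph : ∀ {vs} → Grown R vs → Graph n
  graph t = record
    { _~_ = Edge t ; _~?_ = edge? t ; ~-sym = edge-sym t ; ~-irrefl = edge-irrefl t }

  connected-within : ∀ {vs} (t : Grown R vs) {u v} → u ∈ vs → v ∈ vs → Star (Edge t) u v
  connected-within (root r) (here refl) (here refl) = ε
  connected-within t′@(grow {s} {w} {vs} t s∈vs _ _) u∈ v∈ =
    from-s u∈ ◅◅ reverse (edge-sym t′) (from-s v∈)
    where
    from-s : ∀ {u} → u ∈ w ∷ vs → Star (Edge t′) u s
    from-s (here refl) = inj₂ (refl , refl) ◅ ε
    from-s (there u∈vs) = gmap id (inj₁ ∘ inj₁) (connected-within t u∈vs s∈vs)

  -- Induction on the last leaf `w`. On a cycle through `w` its two distinct neighbours would both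
  -- be `s`; a cycle avoiding `w` lies in the smaller tree.
  acyclic : ∀ {vs} (t : Grown R vs) → ¬ Cycle (graph t)
  acyclic (root r) C = Cycle.close C
  acyclic t′@(grow {s} {w} t s∈vs w∉vs _) C with any? (λ i → Cycle.vertex C i ≟ w)
  ... | yes (i , i≡w) with cycle-neighbours (graph t′) C i
  ...   | j , l , j≢l , e , f = j≢l (Cycle.injective C (trans (leaf i≡w e) (sym (leaf i≡w f))))
    where
    leaf : ∀ {u v} → u ≡ w → Edge t′ u v → v ≡ s
    leaf refl (inj₁ (inj₁ e)) = ⊥-elim (w∉vs (edge-∈ t e))
    leaf refl (inj₁ (inj₂ (refl , _))) = ⊥-elim (w∉vs s∈vs)
    leaf refl (inj₂ (_ , v≡s)) = v≡s
  acyclic t′@(grow {s} {w} t _ _ _) C | no w∉C = acyclic t record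
    { vertex = vertex ; injective = injective
    ; step = λ i → restrict (step i) ; close = restrict close }
    where
    open Cycle C
    restrict : ∀ {i j} → Edge t′ (vertex i) (vertex j) → Edge t (vertex i) (vertex j)
    restrict (inj₁ (inj₁ e)) = e
    restrict (inj₁ (inj₂ (_ , eq))) = ⊥-elim (w∉C (_ , eq))
    restrict (inj₂ (eq , _)) = ⊥-elim (w∉C (_ , eq))

-- Recolouring preserves consecutive colours only inside the tree, hence the restriction to listed
-- vertices.
grown-map : ∀ {R Q : Rel (Fin n) 0ℓ} {vs} →
            (∀ {u v} → u ∈ vs → v ∈ vs → R u v → Q u v) → Grown R vs → Grown Q vs
grown-map f (root r) = root r
grown-map f (grow t s∈vs w∉vs r) =
  grow (grown-map (λ u∈ v∈ → f (there u∈) (there v∈)) t) s∈vs w∉vs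
    (f (there s∈vs) (here refl) r)

-- Exchanging adjacent colours.

-- The bound by `a ⊔ b` keeps the new colour in the palette; the strict decrease makes `extend`
-- terminate.
toward : ∀ a b → a ≢ b → ∃[ b′ ] b′ ≤ a ⊔ b × ∣ b - b′ ∣ ≡ 1 × ∣ a - b′ ∣ < ∣ a - b ∣
toward zero zero a≢b = ⊥-elim (a≢b refl)
toward zero (suc b) _ = b , ℕ.n≤1+n b , ∣1+n-n∣≡1 b , ℕ.≤-refl
  where
  ∣1+n-n∣≡1 : ∀ m → ∣ suc m - m ∣ ≡ 1
  ∣1+n-n∣≡1 zero = refl
  ∣1+n-n∣≡1 (suc m) = ∣1+n-n∣≡1 m
toward (suc a) zero _ = 1 , s≤s z≤n , refl , s≤s (ℕ.≤-reflexive (ℕ.∣-∣-identityʳ a))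
toward (suc a) (suc b) a≢b with toward a b (a≢b ∘ cong suc)
... | b′ , b′≤ , one , closer = suc b′ , s≤s b′≤ , one , closer

toward-Fin : (a b : Fin k) → a ≢ b →
             ∃[ b′ ] ∣ toℕ b - toℕ b′ ∣ ≡ 1 × ∣ toℕ a - toℕ b′ ∣ < ∣ toℕ a - toℕ b ∣
toward-Fin a b a≢b with toward (toℕ a) (toℕ b) (a≢b ∘ toℕ-injective)
... | b′ , b′≤ , one , closer = fromℕ< b′<k ,
  subst (λ x → ∣ toℕ b - x ∣ ≡ 1) (sym (toℕ-fromℕ< b′<k)) one ,
  subst (λ x → ∣ toℕ a - x ∣ < ∣ toℕ a - toℕ b ∣) (sym (toℕ-fromℕ< b′<k)) closer
  where b′<k = ℕ.≤-<-trans b′≤ (ℕ.⊔-lub (toℕ<n a) (toℕ<n b))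

transpose-injective : (i j : Fin k) → Injective _≡_ _≡_ (transpose i j)
transpose-injective i j {x} {y} eq =
  trans (sym (transpose-inverse j i)) (trans (cong (transpose j i) eq) (transpose-inverse j i))

transpose-matchˡ : (i j : Fin k) → transpose i j i ≡ j
transpose-matchˡ i j with i ≟ i
... | yes _ = refl
... | no i≢i = ⊥-elim (i≢i refl)

-- An edge made monochromatic by applying the exchange at one end alone must therefore have joined
-- consecutive colours.
transpose-moves : (i j : Fin k) → ∣ toℕ i - toℕ j ∣ ≡ 1 → ∀ x →
                  transpose i j x ≡ x ⊎ ∣ toℕ (transpose i j x) - toℕ x ∣ ≡ 1
transpose-moves i j one x with x ≟ i
... | yes refl = inj₂ (trans (ℕ.∣-∣-comm (toℕ j) (toℕ i)) one)
... | no _ with x ≟ j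
...   | yes refl = inj₂ one
...   | no _ = inj₁ refl

-- Recolouring while the tree grows.

module _ (G : Graph n) where
  open Graph G

  Consecutive : (Fin n → Fin k) → Rel (Fin n) 0ℓ
  Consecutive c u v = u ~ v × ∣ toℕ (c u) - toℕ (c v) ∣ ≡ 1

  consecutive? : (c : Fin n → Fin k) → ∀ u v → Dec (Consecutive c u v)
  consecutive? c u v = (u ~? v) ×-dec (_ ℕ.≟ 1)

  consecutive-sym : (c : Fin n → Fin k) → Symmetric (Consecutive c)
  consecutive-sym c {u} {v} (e , one) =
    ~-sym e , trans (ℕ.∣-∣-comm (toℕ (c v)) (toℕ (c u))) one

  Extension : ∀ k → List (Fin n) → Set
  Extension k vs = ∃[ c ] ∃[ w ] Proper G k c × Grown (Consecutive c) (w ∷ vs)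

  module _ (vs : List (Fin n)) where

    outside : (Fin k → Fin k) → (Fin n → Fin k) → Fin n → Fin k
    outside π c v with v ∈? vs
    ... | yes _ = c v
    ... | no _ = π (c v)

    outside-∈ : ∀ (π : Fin k → Fin k) c {v} → v ∈ vs → outside π c v ≡ c v
    outside-∈ π c {v} v∈vs with v ∈? vs
    ... | yes _ = refl
    ... | no v∉vs = ⊥-elim (v∉vs v∈vs)

    outside-∉ : ∀ (π : Fin k → Fin k) c {v} → v ∉ vs → outside π c v ≡ π (c v)
    outside-∉ π c {v} v∉vs with v ∈? vs
    ... | yes v∈vs = ⊥-elim (v∉vs v∈vs)
    ... | no _ = refl

    outside-proper : ∀ {π : Fin k → Fin k} {c} → Proper G k c → Injective _≡_ _≡_ π →
      (∀ {s w} → s ∈ vs → w ∉ vs → s ~ w → c s ≢ π (c w)) → Proper G k (outside π c)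
    outside-proper proper π-inj apart u v e with u ∈? vs | v ∈? vs
    ... | yes _ | yes _ = proper u v e
    ... | yes u∈vs | no v∉vs = apart u∈vs v∉vs e
    ... | no u∉vs | yes v∈vs = apart v∈vs u∉vs (~-sym e) ∘ sym
    ... | no _ | no _ = proper u v e ∘ π-inj

    -- The edge `s ~ w` stays the same throughout the recursion: each round fixes `c s` and moves
    -- `c w` one step closer. The search succeeds at the latest when `s ~ w` itself joins
    -- consecutive colours.
    extend : ∀ {s w} (c : Fin n → Fin k) → Proper G k c → Grown (Consecutive c) vs →
             s ∈ vs → w ∉ vs → s ~ w → Acc _<_ ∣ toℕ (c s) - toℕ (c w) ∣ → Extension k vs
    extend {k} {s} {w} c proper t s∈vs w∉vs s~w (acc rec)
      with any? (λ x → any? (λ y → (x ∈? vs) ×-dec ¬? (y ∈? vs) ×-dec consecutive? c x y))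
    ... | yes (x , y , x∈vs , y∉vs , xy) = c , y , proper , grow t x∈vs y∉vs xy
    ... | no none with toward-Fin (c s) (c w) (proper s w s~w)
    ...   | b , one , closer =
      extend c′ (outside-proper proper (transpose-injective (c w) b) apart)
        (grown-map transfer t) s∈vs w∉vs s~w (rec closer′)
      where
      π = transpose (c w) b
      c′ = outside π c

      apart : ∀ {x y} → x ∈ vs → y ∉ vs → x ~ y → c x ≢ π (c y)
      apart {x} {y} x∈vs y∉vs e eq with transpose-moves (c w) b one (c y)
      ... | inj₁ fixed = proper x y e (trans eq fixed)
      ... | inj₂ moved = none (x , y , x∈vs , y∉vs , e ,
        subst (λ z → ∣ toℕ z - toℕ (c y) ∣ ≡ 1) (sym eq) moved)

      transfer : ∀ {x y} → x ∈ vs → y ∈ vs → Consecutive c x y → Consecutive c′ x y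
      transfer x∈vs y∈vs (e , one) = e ,
        trans (cong₂ (λ i j → ∣ toℕ i - toℕ j ∣) (outside-∈ π c x∈vs) (outside-∈ π c y∈vs)) one

      closer′ : ∣ toℕ (c′ s) - toℕ (c′ w) ∣ < ∣ toℕ (c s) - toℕ (c w) ∣
      closer′ = subst₂ (λ i j → ∣ toℕ i - toℕ j ∣ < ∣ toℕ (c s) - toℕ (c w) ∣)
        (sym (outside-∈ π c s∈vs))
        (sym (trans (outside-∉ π c w∉vs) (transpose-matchˡ (c w) b))) closer

  -- The number `m` bounds the remaining rounds: each lengthens `vs` by one, and at zero there would
  -- be more than `n` distinct tree vertices. Walks out of the tree start at `r`.
  spanning : Connected G → ∀ m {r vs} → n < m + length vs → r ∈ vs →
             (c : Fin n → Fin k) → Proper G k c → Grown (Consecutive c) vs →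
             ∃[ c′ ] Proper G k c′ × ∃[ vs′ ] Grown (Consecutive c′) vs′ × (∀ v → v ∈ vs′)
  spanning conn zero n< _ c _ t = ⊥-elim (ℕ.<⇒≱ n< (length≤ t))
  spanning conn (suc m) {r} {vs} n< r∈vs c proper t with all? (_∈? vs)
  ... | yes all∈ = c , proper , vs , t , all∈
  ... | no ¬all with ¬∀⟶∃¬ n _ (_∈? vs) ¬all
  ...   | v , v∉vs with crossing (_∈? vs) (conn r v) r∈vs v∉vs
  ...     | s , w , s∈vs , w∉vs , e
            with extend vs c proper t s∈vs w∉vs e (<-wellFounded _)
  ...       | c′ , _ , proper′ , t′ =
    spanning conn m (subst (n <_) (sym (ℕ.+-suc m _)) n<) (there r∈vs) c′ proper′ t′

  consecutive-tree : Connected G → Fin n → Colorable G k →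
    ∃[ c ] Proper G k c × ∃[ T ] IsSpanningTree G T ×
      (∀ {u v} → Graph._~_ T u v → ∣ toℕ (c u) - toℕ (c v) ∣ ≡ 1)
  consecutive-tree conn r (_ , c , proper)
    with spanning conn n (ℕ.≤-reflexive (sym (ℕ.+-comm n 1))) (here refl) c proper (root r)
  ... | c′ , proper′ , vs , t , all∈ = c′ , proper′ , graph t ,
    ( (λ e → proj₁ (edge⇒R (consecutive-sym c′) t e))
    , (λ u v → connected-within t (all∈ u) (all∈ v)) , acyclic t ) ,
    (λ e → proj₂ (edge⇒R (consecutive-sym c′) t e))

-- Spreading consecutive colours apart.

spread : ℕ → ℕ → ℕ
spread d zero = d
spread d (suc zero) = zero
spread d (suc (suc x)) = suc (spread d x)

-- The images of `2i` and `2i + 1` differ by `d`, those of `2i + 1` and `2i + 2` by `d + 1`.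
spread-far : ∀ d x y → ∣ x - y ∣ ≡ 1 → d ≤ ∣ spread d x - spread d y ∣
spread-far d zero (suc zero) _ = ℕ.≤-reflexive (sym (ℕ.∣-∣-identityʳ d))
spread-far d (suc zero) zero _ = ℕ.≤-refl
spread-far d (suc zero) (suc (suc zero)) _ = ℕ.n≤1+n d
spread-far d (suc (suc zero)) (suc zero) _ = ℕ.n≤1+n d
spread-far d (suc (suc x)) (suc (suc y)) one = spread-far d x y one

spread-< : ∀ d k x → x < k → spread d x < ⌈ k /2⌉ + d
spread-< d (suc zero) zero _ = ℕ.≤-refl
spread-< d (suc zero) (suc x) (s≤s ())
spread-< d (suc (suc k)) zero _ = s≤s (ℕ.m≤n+m d _)
spread-< d (suc (suc k)) (suc zero) _ = s≤s z≤n
spread-< d (suc (suc k)) (suc (suc x)) (s≤s (s≤s x<k)) = s≤s (spread-< d k x x<k)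

-- Besides `0`, only the colour `2d + 1` goes to `d`, and the bound excludes it. The counter `j`
-- records the pairs stripped so far: `j + spread d y` is the image of `y + 2j`.
spread-max : ∀ d j y → y + (j + j) ≤ d + d → j + spread d y ≡ d → j ≡ 0 × y ≡ 0
spread-max d j zero _ eq = ℕ.+-cancelʳ-≡ d j 0 eq , refl
spread-max d j (suc zero) bound eq rewrite ℕ.+-identityʳ j | eq =
  ⊥-elim (ℕ.1+n≰n bound)
spread-max d j (suc (suc y)) bound eq
  with spread-max d (suc j) y
         (subst (_≤ d + d) (sym (trans (cong (y +_) (cong suc (ℕ.+-suc j j)))
            (trans (ℕ.+-suc y (suc (j + j))) (cong suc (ℕ.+-suc y (j + j)))))) bound)
         (trans (sym (ℕ.+-suc j _)) eq)
-- The recursive call would give `suc j ≡ 0`.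
... | () , _

spread-injective : ∀ d x y → x ≤ d + d → y ≤ d + d → spread d x ≡ spread d y → x ≡ y
spread-injective d zero y _ y≤ eq =
  sym (proj₂ (spread-max d 0 y (subst (_≤ d + d) (sym (ℕ.+-identityʳ y)) y≤) (sym eq)))
spread-injective d x zero x≤ _ eq =
  proj₂ (spread-max d 0 x (subst (_≤ d + d) (sym (ℕ.+-identityʳ x)) x≤) eq)
spread-injective d (suc zero) (suc zero) _ _ _ = refl
spread-injective d (suc (suc x)) (suc (suc y)) x≤ y≤ eq = cong (λ z → suc (suc z))
  (spread-injective d x y (ℕ.≤-trans (ℕ.m≤n+m x 2) x≤) (ℕ.≤-trans (ℕ.m≤n+m y 2) y≤)
    (ℕ.suc-injective eq))

<⇒≤2d : ∀ {d k x} → ⌊ k /2⌋ ≤ d → x < k → x ≤ d + d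
<⇒≤2d {d} {k} {x} half x<k = ℕ.≤-pred (begin
  suc x                     ≤⟨ x<k ⟩
  -- By definition `⌈ k /2⌉` is `⌊ suc k /2⌋`, and `suc ⌊ k /2⌋` is `⌊ suc (suc k) /2⌋`.
  k                         ≡⟨ ℕ.⌊n/2⌋+⌈n/2⌉≡n k ⟨
  ⌊ k /2⌋ + ⌈ k /2⌉         ≤⟨ ℕ.+-monoʳ-≤ ⌊ k /2⌋ (ℕ.⌊n/2⌋-mono (ℕ.n≤1+n (suc k))) ⟩
  ⌊ k /2⌋ + suc ⌊ k /2⌋     ≤⟨ ℕ.+-mono-≤ half (s≤s half) ⟩
  d + suc d                 ≡⟨ ℕ.+-suc d d ⟩
  suc (d + d)               ∎)
  where open ℕ.≤-Reasoning

proper-∘ : (G : Graph n) {j k : ℕ} (f : Fin j → Fin k) → Injective _≡_ _≡_ f →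
           ∀ {c} → Proper G j c → Proper G k (f ∘ c)
proper-∘ G f inj proper u v e = proper u v e ∘ inj

-- The two bounds on `d` serve different ends: `⌊ k /2⌋ ≤ d` makes the substitution injective on the
-- `k` colours, and `q ≤ d` gives tree edges their gap.
spread-backbone : (G T : Graph n) → ∀ {q d k} (c : Fin n → Fin k) → Proper G k c →
  ⌊ k /2⌋ ≤ d → q ≤ d →
  (∀ {u v} → Graph._~_ T u v → ∣ toℕ (c u) - toℕ (c v) ∣ ≡ 1) →
  ∃ (Backbone G T q (⌈ k /2⌉ + d))
spread-backbone G T {q} {d} {k} c proper half q≤d consecutive =
  f ∘ c , proper-∘ G f f-injective {c} proper , λ u v e →
    ℕ.≤-trans q≤d (subst₂ (λ i j → d ≤ ∣ i - j ∣) (sym (toℕ-f (c u))) (sym (toℕ-f (c v)))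
      (spread-far d (toℕ (c u)) (toℕ (c v)) (consecutive e)))
  where
  bound : (x : Fin k) → spread d (toℕ x) < ⌈ k /2⌉ + d
  bound x = spread-< d k (toℕ x) (toℕ<n x)

  f : Fin k → Fin (⌈ k /2⌉ + d)
  f x = fromℕ< (bound x)

  toℕ-f : ∀ x → toℕ (f x) ≡ spread d (toℕ x)
  toℕ-f x = toℕ-fromℕ< (bound x)

  f-injective : Injective _≡_ _≡_ f
  f-injective {x} {y} eq = toℕ-injective (spread-injective d (toℕ x) (toℕ y)
    (<⇒≤2d half (toℕ<n x)) (<⇒≤2d half (toℕ<n y))
    (fromℕ<-injective _ _ (bound x) (bound y) eq))

-- Folding the extreme colours: the lower bound.

-- If `y` lies above `x`, then `q + x ≤ y < q + e`; if below, then `q ≤ x ∸ y ≤ x`.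
side : ∀ {q e} (x y : ℕ) → x < q + e → y < q + e → q ≤ ∣ x - y ∣ → x < e ⊎ q ≤ x
side {q} {e} x y _ y< far with ℕ.≤-total x y
... | inj₁ x≤y = inj₁ (ℕ.+-cancelˡ-< q x e (begin-strict
  q + x          ≤⟨ ℕ.+-monoˡ-≤ x (subst (q ≤_) (ℕ.m≤n⇒∣m-n∣≡n∸m x≤y) far) ⟩
  (y ∸ x) + x    ≡⟨ ℕ.m∸n+n≡m x≤y ⟩
  y              <⟨ y< ⟩
  q + e          ∎))
  where open ℕ.≤-Reasoning
... | inj₂ y≤x = inj₂ (ℕ.≤-trans
  (subst (q ≤_) (trans (ℕ.∣-∣-comm x y) (ℕ.m≤n⇒∣m-n∣≡n∸m y≤x)) far) (ℕ.m∸n≤m x y))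

half : ∀ q {e} x → x < q + e → x < e ⊎ q ≤ x → Fin e ⊎ Fin e
half q x _ (inj₁ x<e) = inj₁ (fromℕ< x<e)
half q {e} x x< (inj₂ q≤x) = inj₂ (fromℕ< (ℕ.+-cancelˡ-< q (x ∸ q) e
  (subst (_< q + e) (sym (ℕ.m+[n∸m]≡n q≤x)) x<)))

-- The ranges below `e` and from `q` on overlap when `q < e`, so one colour may land in different
-- copies at different vertices. This is harmless: properness needs only that equal images come from
-- equal colours.
half-injective : ∀ q {e} x y (x< : x < q + e) (y< : y < q + e)
                 (p : x < e ⊎ q ≤ x) (r : y < e ⊎ q ≤ y) →
                 half q x x< p ≡ half q y y< r → x ≡ y
half-injective q x y _ _ (inj₁ x<e) (inj₁ y<e) eq =
  fromℕ<-injective x y x<e y<e (inj₁-injective eq)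
half-injective q x y _ _ (inj₂ q≤x) (inj₂ q≤y) eq =
  ℕ.∸-cancelʳ-≡ q≤x q≤y (fromℕ<-injective _ _ _ _ (inj₂-injective eq))

join-injective : ∀ m n → Injective _≡_ _≡_ (join m n)
join-injective m n {x} {y} eq =
  trans (sym (splitAt-join m n x)) (trans (cong (splitAt m) eq) (splitAt-join m n y))

fold-colorable : (G T : Graph n) → ∀ q e → 0 < e → (∀ v → ∃[ w ] Graph._~_ T v w) →
                 BackboneColorable G T q (q + e) → Colorable G (e + e)
fold-colorable G T q e 0<e nbr (_ , c , proper , far) =
  ℕ.≤-trans 0<e (ℕ.m≤m+n e e) , join e e ∘ h , λ u v uv eq →
    proper u v uv (toℕ-injective (half-injective q _ _
      (toℕ<n (c u)) (toℕ<n (c v)) (sides u) (sides v) (join-injective e e eq)))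
  where
  sides : ∀ v → toℕ (c v) < e ⊎ q ≤ toℕ (c v)
  sides v with nbr v
  ... | w , vw = side (toℕ (c v)) (toℕ (c w)) (toℕ<n (c v)) (toℕ<n (c w)) (far v w vw)
  h : ∀ v → Fin e ⊎ Fin e
  h v = half q (toℕ (c v)) (toℕ<n (c v)) (sides v)

lower-bound : 2 ≤ n → (G T : Graph n) → Connected T → ∀ q k {m} → IsMinimum (Colorable G) m →
              BackboneColorable G T q k → m ⊔ (⌈ m /2⌉ + q) ≤ k
lower-bound {suc n} 2≤n G T conn q k {m} (_ , m≤) bc@(0<k , c , proper , far) =
  ℕ.⊔-lub (m≤ k (0<k , c , proper)) bound
  where
  nbr = neighbour T 2≤n conn

  -- A single tree edge has ends `q` apart within `k` colours. Hence `k ∸ q` is positive and loses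
  -- nothing to truncation.
  q<k : q < k
  q<k with nbr zero
  ... | w , vw = ℕ.≤-<-trans (far zero w vw) (ℕ.≤-<-trans
    (ℕ.∣m-n∣≤m⊔n (toℕ (c zero)) (toℕ (c w))) (ℕ.⊔-lub (toℕ<n (c zero)) (toℕ<n (c w))))

  e = k ∸ q
  q+e≡k : q + e ≡ k
  q+e≡k = ℕ.m+[n∸m]≡n (ℕ.<⇒≤ q<k)

  folded : Colorable G (e + e)
  folded = fold-colorable G T q e (ℕ.m<n⇒0<n∸m q<k) nbr
    (subst (BackboneColorable G T q) (sym q+e≡k) bc)

  bound : ⌈ m /2⌉ + q ≤ k
  bound = begin
    ⌈ m /2⌉ + q       ≤⟨ ℕ.+-monoˡ-≤ q (ℕ.⌈n/2⌉-mono (m≤ (e + e) folded)) ⟩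
    ⌈ e + e /2⌉ + q   ≡⟨ cong (_+ q) (ℕ.n≡⌈n+n/2⌉ e) ⟨
    e + q             ≡⟨ ℕ.+-comm e q ⟩
    q + e             ≡⟨ q+e≡k ⟩
    k                 ∎
    where open ℕ.≤-Reasoning

-- Matching the two bounds.

max-formula : ∀ k q → ⌈ k /2⌉ + (⌊ k /2⌋ ⊔ q) ≡ k ⊔ (⌈ k /2⌉ + q)
max-formula k q = trans (ℕ.+-distribˡ-⊔ ⌈ k /2⌉ ⌊ k /2⌋ q)
  (cong (_⊔ (⌈ k /2⌉ + q)) (trans (ℕ.+-comm ⌈ k /2⌉ ⌊ k /2⌋) (ℕ.⌊n/2⌋+⌈n/2⌉≡n k)))

upper-bound : 1 ≤ n → (G : Graph n) → Connected G → ∀ q {m} → Colorable G m →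
  ∃[ T ] IsSpanningTree G T × BackboneColorable G T q (m ⊔ (⌈ m /2⌉ + q))
upper-bound {suc n} _ G conn q {m} colorable with consecutive-tree G conn zero colorable
... | c , proper , T , tree , consecutive = T , tree ,
  ℕ.≤-trans (proj₁ colorable) (ℕ.m≤m⊔n m _) ,
  subst (λ k → ∃ (Backbone G T q k)) (max-formula m q)
    (spread-backbone G T c proper (ℕ.m≤m⊔n ⌊ m /2⌋ q) (ℕ.m≤n⊔m ⌊ m /2⌋ q) consecutive)

-- Abstracting from χ and BBC keeps their exhaustive searches from being unfolded.
minimum-over-trees : 2 ≤ n → (G : Graph n) → Connected G → ∀ q {m} → IsMinimum (Colorable G) m →
  (b : Graph n → ℕ) → (∀ T → IsMinimum (BackboneColorable G T q) (b T)) →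
  IsMinimum (λ k → ∃[ T ] IsSpanningTree G T × b T ≡ k) (m ⊔ (⌈ m /2⌉ + q))
minimum-over-trees 2≤n G conn q {m} m-min b b-min
  with upper-bound (ℕ.≤-trans (ℕ.n≤1+n 1) 2≤n) G conn q (proj₁ m-min)
... | T , tree , colorable =
  -- The lower bound, applied to the tree built for the upper bound, shows that this tree attains
  -- the value exactly.
  (T , tree , ℕ.≤-antisym (proj₂ (b-min T) _ colorable) (bound T tree)) ,
  λ { j (T′ , tree′ , refl) → bound T′ tree′ }
  where
  bound : ∀ T → IsSpanningTree G T → m ⊔ (⌈ m /2⌉ + q) ≤ b T
  bound T (_ , conn-T , _) = lower-bound 2≤n G T conn-T q _ m-min (proj₁ (b-min T))

theorem2 : (n : ℕ) → 2 ≤ n → (G : Graph n) → Connected G → (q : ℕ) → 1 ≤ q → Is𝓑 q G (χ G ⊔ (⌈ χ G /2⌉ + q))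
theorem2 n 2≤n G conn q _ =
  minimum-over-trees 2≤n G conn q (χ-isMinimum G) (BBC q G) (BBC-isMinimum q G)
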